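{- Let $C$ be a dendritic face complex. Then the relation $<^+$ on $C_0$ is a strict total (linear) order: any two distinct elements of $C_0$ are comparable for $<^+$.
   Context: A positive-to-one poset (POP) is a finite set $P$ with $\dim:P\to\mathbb{N}$ and binary relations $\prec^-,\prec^+$; $y\prec x$ means $y\prec^-x$ or $y\prec^+x$. Axioms: $y\prec x\Rightarrow\dim x=\dim y+1$; never both $y\prec^-x$ and $y\prec^+x$; every $x$ with $\dim x\ge1$ has exactly one $y$ with $y\prec^+x$, denoted $\gamma(x)$, and at least one $y$ with $y\prec^-x$. $\delta(x)=\{y:y\prec^-x\}$, $C_k=\dim^{ -1}(k)$; $\le$ is the reflexive-transitive closure of $\prec$. A dendritic face complex is a POP such that: it has a greatest element for $\le$; (oriented thinness) whenever $z\prec^{\beta}y\prec^{\alpha}x$ there is a unique $y'\ne y$ with $z\prec y'\prec x$, and writing $z\prec^{\beta'}y'\prec^{\alpha'}x$ the signs (as $\pm1$) satisfy $\alpha\beta=-\alpha'\beta'$; (acyclicity) $\delta(x)$ is a singleton if $\dim x=1$, nonempty if $\dim x\ge1$, and for $\dim x\ge1$ there are no $p\ge1$, $y_1,\dots,y_p\in\delta(x)$ with $\gamma(y_{i+1})\in\delta(y_i)$ ($1\le i<p$) and $\gamma(y_1)\in\delta(y_p)$. For $a,b\in C_k$, $a\triangleleft^+b$ iff there is $c\in C_{k+1}$ with $a\prec^-c$ and $b=\gamma(c)$; $<^+$ is the transitive closure of $\triangleleft^+$. -}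

module Defs where

open import Data.Nat using (ℕ; zero; suc; _≤_)
open import Data.Fin using (Fin; inject₁; fromℕ) renaming (zero to fzero; suc to fsuc)
open import Data.Sign using (Sign; opposite) renaming (_*_ to _·_)
open import Data.Product using (Σ; ∃; _×_; _,_)
open import Data.Sum using (_⊎_)
open import Data.Empty using (⊥)
open import Relation.Nullary using (¬_)
open import Relation.Binary using (Decidable)
open import Relation.Binary.PropositionalEquality using (_≡_; _≢_)
open import Relation.Binary.Construct.Closure.ReflexiveTransitive using (Star)
open import Relation.Binary.Construct.Closure.Transitive using (TransClosure)

-- A positive-to-one poset on the finite carrier Fin n.
-- rel s y x  means  y ≺^s x  (s = - or +).
record POP (n : ℕ) : Set₁ where
  field
    dim : Fin n → ℕ
    rel : Sign → Fin n → Fin n → Set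
    rel-dec : ∀ s → Decidable (rel s)
  _≺⁻_ : Fin n → Fin n → Set
  y ≺⁻ x = rel Sign.- y x
  _≺⁺_ : Fin n → Fin n → Set
  y ≺⁺ x = rel Sign.+ y x
  _≺_ : Fin n → Fin n → Set
  y ≺ x = y ≺⁻ x ⊎ y ≺⁺ x
  field
    ≺-dim : ∀ {y x} → y ≺ x → dim x ≡ suc (dim y)
    not-both : ∀ {y x} → y ≺⁻ x → y ≺⁺ x → ⊥
    γ-exists : ∀ x → 1 ≤ dim x → ∃ λ y → y ≺⁺ x
    γ-unique : ∀ {x y y′} → y ≺⁺ x → y′ ≺⁺ x → y ≡ y′
    δ-nonempty : ∀ x → 1 ≤ dim x → ∃ λ y → y ≺⁻ x
  -- ≤ : reflexive-transitive closure of ≺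
  _≤P_ : Fin n → Fin n → Set
  _≤P_ = Star _≺_
  -- "γ(b) ∈ δ(a)", stated relationally (γ(b) is the unique w with w ≺⁺ b)
  γ∈δ : Fin n → Fin n → Set
  γ∈δ b a = ∃ λ w → w ≺⁺ b × w ≺⁻ a
  -- a ◁⁺ b  iff  ∃ c, a ≺⁻ c and b = γ(c)
  _◁⁺_ : Fin n → Fin n → Set
  a ◁⁺ b = ∃ λ c → a ≺⁻ c × b ≺⁺ c
  _<⁺_ : Fin n → Fin n → Set
  _<⁺_ = TransClosure _◁⁺_

record IsDendritic {n : ℕ} (P : POP n) : Set where
  open POP P
  field
    greatest : ∃ λ t → ∀ x → x ≤P t
    oriented-thin : ∀ {z y x} β α → rel β z y → rel α y x →
      Σ (Fin n) λ y′ → y′ ≢ y × z ≺ y′ × y′ ≺ x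
        × (∀ y″ → y″ ≢ y → z ≺ y″ → y″ ≺ x → y″ ≡ y′)
        × (∀ β′ α′ → rel β′ z y′ → rel α′ y′ x → α · β ≡ opposite (α′ · β′))
    δ-singleton : ∀ x → dim x ≡ 1 → ∀ {y y′} → y ≺⁻ x → y′ ≺⁻ x → y ≡ y′
    acyclic : ∀ x → 1 ≤ dim x → ∀ p → (ys : Fin (suc p) → Fin n) →
      (∀ i → ys i ≺⁻ x) →
      (∀ (i : Fin p) → γ∈δ (ys (fsuc i)) (ys (inject₁ i))) →
      γ∈δ (ys fzero) (ys (fromℕ p)) → ⊥

record DendriticFaceComplex : Set₁ where
  field
    size : ℕ
    pop : POP size
    isDendritic : IsDendritic pop
  open POP pop public

{-# OPTIONS --safe #-}
-- Let t be the greatest cell. When dim t ≥ 2, descend along output faces t, γ t, γ² t, … to a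
-- 2-cell b. Induction on dimension, with an inner well-founded induction over the input faces of
-- each cell (this is where acyclicity enters), shows that the endpoints of every edge below t are
-- joined by a path of steps along input edges of b; so on vertices <⁺ is the transitive closure of
-- these steps. The steps are deterministic (oriented thinness), close no cycle (acyclicity of b),
-- and reach every vertex of b from the source of γ b, hence they order the vertices linearly.
-- When dim t ≤ 1 there are at most two vertices.
module Submission where

open import Defs
open import Data.Sum using (_⊎_)
open import Data.Product using (_×_)
open import Relation.Nullary using (¬_)
open import Relation.Binary.PropositionalEquality using (_≡_; _≢_)

open import Level using (Level; 0ℓ)
open import Function using (_∘_)
open import Data.Empty using (⊥; ⊥-elim)
open import Data.Nat using (ℕ; zero; suc; _+_; _≤_; _<_; z≤n; s≤s; s≤s⁻¹)
open import Data.Nat.Properties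
  using ( suc-injective; ≤-refl; ≤-antisym; <⇒≤; <-irrefl; <-trans; 1+n≰n; 1+n≢n; n≮0; n<1+n
        ; m≤m+n; +-suc; +-identityʳ; +-monoʳ-<; m≤n⇒∃[o]m+o≡n)
open import Data.Fin using (Fin; toℕ; inject₁; fromℕ) renaming (zero to fzero; suc to fsuc)
open import Data.Fin.Properties using (pigeonhole; toℕ<n; toℕ-inject₁; toℕ-fromℕ; _≟_)
open import Data.Product using (Σ; ∃; _,_; proj₁; proj₂)
import Data.Product as Product
open import Data.Sum using (inj₁; inj₂)
import Data.Sum as Sum
open import Data.Sign using (Sign; opposite) renaming (_*_ to _·_)
open import Relation.Nullary using (yes; no)
open import Relation.Binary using (Rel)
open import Relation.Binary.Rewriting using (Deterministic)
open import Relation.Binary.PropositionalEquality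
  using (refl; sym; trans; cong; subst; subst₂; module ≡-Reasoning)
open ≡-Reasoning
open import Relation.Binary.Construct.Closure.ReflexiveTransitive using (Star; ε; _◅_; _◅◅_)
open import Relation.Binary.Construct.Closure.Transitive using (TransClosure; [_]; _∷_; _++_)
import Relation.Binary.Construct.Closure.Transitive as Plus
open import Induction.WellFounded using (Acc; acc; WellFounded; wf⇒asym)

module _ {a ℓ : Level} {A : Set a} {_∼_ : Rel A ℓ} where

  ⁺⇒⋆ : ∀ {x y} → TransClosure _∼_ x y → Star _∼_ x y
  ⁺⇒⋆ [ r ] = r ◅ ε
  ⁺⇒⋆ (r ∷ p) = r ◅ ⁺⇒⋆ p

  ◅⇒⁺ : ∀ {x y z} → x ∼ y → Star _∼_ y z → TransClosure _∼_ x z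
  ◅⇒⁺ r ε = [ r ]
  ◅⇒⁺ r (s ◅ p) = r ∷ ◅⇒⁺ s p

  ⋆⇒⁺ : ∀ {x y} → Star _∼_ x y → x ≢ y → TransClosure _∼_ x y
  ⋆⇒⁺ ε x≢x = ⊥-elim (x≢x refl)
  ⋆⇒⁺ (r ◅ p) _ = ◅⇒⁺ r p

  uncons⁺ : ∀ {x z} → TransClosure _∼_ x z → ∃ λ y → x ∼ y × Star _∼_ y z
  uncons⁺ [ r ] = _ , r , ε
  uncons⁺ (r ∷ p) = _ , r , ⁺⇒⋆ p

  last⁺ : ∀ {x z} → TransClosure _∼_ x z → ∃ λ y → y ∼ z
  last⁺ [ r ] = _ , r
  last⁺ (_ ∷ p) = last⁺ p

  unsnoc⋆ : ∀ {x z} → Star _∼_ x z → x ≡ z ⊎ ∃ λ y → Star _∼_ x y × y ∼ z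
  unsnoc⋆ ε = inj₁ refl
  unsnoc⋆ (r ◅ p) with unsnoc⋆ p
  ... | inj₁ refl = inj₂ (_ , ε , r)
  ... | inj₂ (y , q , s) = inj₂ (y , r ◅ q , s)

  concatMap⁺ : ∀ {ℓ′} {_≈_ : Rel A ℓ′} → (∀ {x y} → x ∼ y → TransClosure _≈_ x y) →
               ∀ {x y} → TransClosure _∼_ x y → TransClosure _≈_ x y
  concatMap⁺ f [ r ] = f r
  concatMap⁺ f (r ∷ p) = f r ++ concatMap⁺ f p

  ⋆-comparable : Deterministic _≡_ _∼_ → ∀ {s u v} → Star _∼_ s u → Star _∼_ s v →
                 Star _∼_ u v ⊎ Star _∼_ v u
  ⋆-comparable det ε q = inj₁ q
  ⋆-comparable det p ε = inj₂ p
  ⋆-comparable det (r ◅ p) (r′ ◅ q) with det r r′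
  ... | refl = ⋆-comparable det p q

module _ {n : ℕ} (_⊏_ : Rel (Fin n) 0ℓ) where

  NoCycle : Set
  NoCycle = ∀ p (ys : Fin (suc p) → Fin n) →
    (∀ (i : Fin p) → ys (fsuc i) ⊏ ys (inject₁ i)) → ys fzero ⊏ ys (fromℕ p) → ⊥

  DescendingFrom : Fin n → ℕ → Set
  DescendingFrom y f = Σ (ℕ → Fin n) λ c → c 0 ≡ y × (∀ m → m < f → c (suc m) ⊏ c m)

  acc-if-no-descent : ∀ f y → ¬ DescendingFrom y f → Acc _⊏_ y
  acc-if-no-descent zero y none = ⊥-elim (none ((λ _ → y) , refl , λ _ ()))
  acc-if-no-descent (suc f) y none =
    acc λ x⊏y → acc-if-no-descent f _ λ (c , c0≡x , desc) → none (prepend c c0≡x desc x⊏y)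
    where
    prepend : ∀ {x} c → c 0 ≡ x → (∀ m → m < f → c (suc m) ⊏ c m) → x ⊏ y → DescendingFrom y (suc f)
    prepend c refl desc x⊏y = cons , refl , descending
      where
      cons : ℕ → Fin n
      cons zero = y
      cons (suc m) = c m
      descending : ∀ m → m < suc f → cons (suc m) ⊏ cons m
      descending zero _ = x⊏y
      descending (suc m) m<f = desc m (s≤s⁻¹ m<f)

  -- A descending chain of length n repeats an element (pigeonhole); the segment between is a cycle.
  no-descent-of-length-n : NoCycle → ∀ y → ¬ DescendingFrom y n
  no-descent-of-length-n noCycle y (c , _ , desc)
    with i , j , i<j , cᵢ≡cⱼ ← pigeonhole (n<1+n n) (c ∘ toℕ)
    with p , i+1+p≡j ← m≤n⇒∃[o]m+o≡n i<j
    = noCycle p (λ k → c (toℕ i + toℕ k)) chain close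
    where
    i+p<n : toℕ i + p < n
    i+p<n = subst (_≤ n) (sym i+1+p≡j) (s≤s⁻¹ (toℕ<n j))
    chain : ∀ (k : Fin p) → c (toℕ i + toℕ (fsuc k)) ⊏ c (toℕ i + toℕ (inject₁ k))
    chain k = subst₂ _⊏_ (cong c (sym (+-suc (toℕ i) (toℕ k))))
                          (cong (λ m → c (toℕ i + m)) (sym (toℕ-inject₁ k)))
                          (desc _ (<-trans (+-monoʳ-< (toℕ i) (toℕ<n k)) i+p<n))
    repeat : c (suc (toℕ i + p)) ≡ c (toℕ i + 0)
    repeat = begin
      c (suc (toℕ i + p))  ≡⟨ cong c i+1+p≡j ⟩
      c (toℕ j)            ≡⟨ sym cᵢ≡cⱼ ⟩
      c (toℕ i)            ≡⟨ cong c (sym (+-identityʳ (toℕ i))) ⟩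
      c (toℕ i + 0)        ∎
    close : c (toℕ i + 0) ⊏ c (toℕ i + toℕ (fromℕ p))
    close = subst₂ _⊏_ repeat
                       (cong (λ m → c (toℕ i + m)) (sym (toℕ-fromℕ p)))
                       (desc _ i+p<n)

  noCycle⇒wellFounded : NoCycle → WellFounded _⊏_
  noCycle⇒wellFounded noCycle y = acc-if-no-descent n y (no-descent-of-length-n noCycle y)

module _ (C : DendriticFaceComplex) where
  open DendriticFaceComplex C
  open IsDendritic isDendritic

  private
    El : Set
    El = Fin size

  ≺-dim-pred : ∀ {y x n} → y ≺ x → dim x ≡ suc n → dim y ≡ n
  ≺-dim-pred r d = suc-injective (trans (sym (≺-dim r)) d)

  ≡suc⇒1≤dim : ∀ {x n} → dim x ≡ suc n → 1 ≤ dim x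
  ≡suc⇒1≤dim d = subst (1 ≤_) (sym d) (s≤s z≤n)

  ≺⇒1≤dim : ∀ {y x} → y ≺ x → 1 ≤ dim x
  ≺⇒1≤dim r = ≡suc⇒1≤dim (≺-dim r)

  ≺◅≤P-dim< : ∀ {a c b} → a ≺ c → c ≤P b → dim a < dim b

  ≤P-dim : ∀ {a b} → a ≤P b → dim a ≤ dim b
  ≤P-dim ε = ≤-refl
  ≤P-dim (r ◅ p) = <⇒≤ (≺◅≤P-dim< r p)

  ≺◅≤P-dim< {b = b} r p = subst (_≤ dim b) (≺-dim r) (≤P-dim p)

  ≤P-dim-≡ : ∀ {a b} → a ≤P b → dim a ≡ dim b → a ≡ b
  ≤P-dim-≡ ε _ = refl
  ≤P-dim-≡ (r ◅ p) d = ⊥-elim (<-irrefl d (≺◅≤P-dim< r p))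

  ≤P-codim1 : ∀ {a b} → a ≤P b → dim b ≡ suc (dim a) → a ≺ b
  ≤P-codim1 ε d = ⊥-elim (1+n≢n (sym d))
  ≤P-codim1 {a} (r ◅ p) d = subst (a ≺_) (≤P-dim-≡ p (trans (≺-dim r) (sym d))) r

  edge-dim : ∀ {u c} → dim u ≡ 0 → u ≺ c → dim c ≡ 1
  edge-dim du uc = trans (≺-dim uc) (cong suc du)

  ◁⁺-vertex : ∀ {u v} → dim u ≡ 0 → u ◁⁺ v → dim v ≡ 0
  ◁⁺-vertex du (_ , uc , vc) = ≺-dim-pred (inj₂ vc) (edge-dim du (inj₁ uc))

  Feeds : El → El → El → Set
  Feeds x a b = a ≺⁻ x × b ≺⁻ x × γ∈δ a b

  feeds-wellFounded : ∀ x → WellFounded (Feeds x)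
  feeds-wellFounded x = noCycle⇒wellFounded (Feeds x) λ p ys chain close →
    acyclic x (≺⇒1≤dim (inj₁ (proj₁ close))) p ys
      (λ { fzero → proj₁ close ; (fsuc i) → proj₁ (chain i) })
      (proj₂ ∘ proj₂ ∘ chain) (proj₂ (proj₂ close))

  private
    signed : ∀ {a b} → a ≺ b → ∃ λ s → rel s a b
    signed (inj₁ r) = Sign.- , r
    signed (inj₂ r) = Sign.+ , r

  OtherFace : El → El → El → Sign → Set
  OtherFace z y x s = ∃ λ y′ → y′ ≢ y × Σ Sign λ β′ → Σ Sign λ α′ →
    rel β′ z y′ × rel α′ y′ x × s ≡ opposite (α′ · β′)

  other-face : ∀ {β α z y x} → rel β z y → rel α y x → OtherFace z y x (α · β)
  other-face {β} {α} r s with oriented-thin β α r s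
  ... | y′ , y′≢y , z≺y′ , y′≺x , _ , signs with signed z≺y′ | signed y′≺x
  ... | β′ , r′ | α′ , s′ = y′ , y′≢y , β′ , α′ , r′ , s′ , signs β′ α′ r′ s′

  Alternating : El → El → Set
  Alternating z x = (∃ λ a → z ≺⁺ a × a ≺⁻ x) ⊎ (∃ λ a → z ≺⁻ a × a ≺⁺ x)

  private
    alternate : ∀ {z y x} → OtherFace z y x Sign.+ → Alternating z x
    alternate (_ , _ , Sign.+ , Sign.- , p , q , _) = inj₁ (_ , p , q)
    alternate (_ , _ , Sign.- , Sign.+ , p , q , _) = inj₂ (_ , p , q)
    alternate (_ , _ , Sign.+ , Sign.+ , _ , _ , ())
    alternate (_ , _ , Sign.- , Sign.- , _ , _ , ())

  ≺≺⇒alternating : ∀ {z y x} → z ≺ y → y ≺ x → Alternating z x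
  ≺≺⇒alternating (inj₂ p) (inj₁ q) = inj₁ (_ , p , q)
  ≺≺⇒alternating (inj₁ p) (inj₂ q) = inj₂ (_ , p , q)
  ≺≺⇒alternating (inj₁ p) (inj₁ q) = alternate (other-face p q)
  ≺≺⇒alternating (inj₂ p) (inj₂ q) = alternate (other-face p q)

  δγ⇒δδ : ∀ {w g y} → w ≺⁻ g → g ≺⁺ y → ∃ λ z → w ≺⁻ z × z ≺⁻ y
  δγ⇒δδ p q with other-face p q
  ... | _ , _ , Sign.- , Sign.- , p′ , q′ , _ = _ , p′ , q′
  ... | _ , y′≢g , Sign.+ , Sign.+ , _ , q′ , _ = ⊥-elim (y′≢g (γ-unique q′ q))
  ... | _ , _ , Sign.+ , Sign.- , _ , _ , ()
  ... | _ , _ , Sign.- , Sign.+ , _ , _ , ()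

  δδ-unique : ∀ {u a a′ x} → u ≺⁻ a → a ≺⁻ x → u ≺⁻ a′ → a′ ≺⁻ x → a ≡ a′
  δδ-unique {a = a} {a′} p q p′ q′ with a ≟ a′
  ... | yes a≡a′ = a≡a′
  ... | no a≢a′ with oriented-thin Sign.- Sign.- p q
  ... | _ , _ , _ , _ , unique , signs with unique a′ (a≢a′ ∘ sym) (inj₁ p′) (inj₁ q′)
  ... | refl with signs Sign.- Sign.- p′ q′
  ... | ()

  infix 4 _◁[_]_ _◁[_]⁺_

  _◁[_]_ : El → El → El → Set
  u ◁[ x ] v = ∃ λ e → e ≺⁻ x × u ≺⁻ e × v ≺⁺ e

  _◁[_]⁺_ : El → El → El → Set
  u ◁[ x ]⁺ v = TransClosure _◁[ x ]_ u v

  ◁[]-deterministic : ∀ {x} → Deterministic _≡_ _◁[ x ]_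
  ◁[]-deterministic (_ , e∈ , ue , ve) (_ , e′∈ , ue′ , v′e′) with δδ-unique ue e∈ ue′ e′∈
  ... | refl = γ-unique ve v′e′

  ◁[]⁺⇒<⁺ : ∀ {x u v} → u ◁[ x ]⁺ v → u <⁺ v
  ◁[]⁺⇒<⁺ = concatMap⁺ λ (e , _ , ue , ve) → [ e , ue , ve ]

  ◁[]⋆⇒feeds⁺ : ∀ {x e e′ v w} → e ≺⁻ x → v ≺⁺ e → Star _◁[ x ]_ v w → w ≺⁻ e′ → e′ ≺⁻ x →
                TransClosure (Feeds x) e e′
  ◁[]⋆⇒feeds⁺ e∈ ve ε we′ e′∈ = [ e∈ , e′∈ , _ , ve , we′ ]
  ◁[]⋆⇒feeds⁺ e∈ ve ((_ , e₁∈ , ve₁ , v₁e₁) ◅ p) we′ e′∈ =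
    (e∈ , e₁∈ , _ , ve , ve₁) ∷ ◁[]⋆⇒feeds⁺ e₁∈ v₁e₁ p we′ e′∈

  ◁[]⁺-irreflexive : ∀ {x u} → ¬ (u ◁[ x ]⁺ u)
  ◁[]⁺-irreflexive {x} p with uncons⁺ p
  ... | _ , (_ , e∈ , ue , ve) , rest = wf⇒asym feeds⁺-wellFounded cycle cycle
    where
    feeds⁺-wellFounded : WellFounded (TransClosure (Feeds x))
    feeds⁺-wellFounded = Plus.wellFounded (Feeds x) (feeds-wellFounded x)
    cycle : TransClosure (Feeds x) _ _
    cycle = ◁[]⋆⇒feeds⁺ e∈ ve rest ue e∈

  VertexOf : El → El → Set
  VertexOf x v = ∃ λ w → v ≺ w × w ≺ x

  ◁[]⁺-source : ∀ {x u v} → u ◁[ x ]⁺ v → VertexOf x u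
  ◁[]⁺-source p with uncons⁺ p
  ... | _ , (e , e∈ , ue , _) , _ = e , inj₁ ue , inj₁ e∈

  ◁[]⁺-target : ∀ {x u v} → u ◁[ x ]⁺ v → VertexOf x v
  ◁[]⁺-target p with last⁺ p
  ... | _ , (e , e∈ , _ , ve) = e , inj₂ ve , inj₁ e∈

  module TwoCell {x g s} (d : dim x ≡ 2) (gx : g ≺⁺ x) (sg : s ≺⁻ g) where

    source-unique : ∀ {u} → u ≺⁻ g → u ≡ s
    source-unique ug = δ-singleton g (≺-dim-pred (inj₂ gx) d) ug sg

    -- A source of a is an output of an input of x feeding a, or else it is the source s of γ x.
    reach-input-target : ∀ {a} → Acc (Feeds x) a → a ≺⁻ x → ∀ {v} → v ≺⁺ a → Star _◁[ x ]_ s v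
    reach-input-target {a} (acc rec) a∈ va with δ-nonempty a (≺⇒1≤dim (inj₂ va))
    ... | u , ua with ≺≺⇒alternating (inj₁ ua) (inj₁ a∈)
    ... | inj₁ (_ , ua′ , a′∈) =
      reach-input-target (rec (a′∈ , a∈ , u , ua′ , ua)) a′∈ ua′ ◅◅ ((a , a∈ , ua , va) ◅ ε)
    ... | inj₂ (_ , ua′ , a′x) with source-unique (subst (u ≺⁻_) (γ-unique a′x gx) ua′)
    ... | refl = (a , a∈ , ua , va) ◅ ε

    reach-vertex : ∀ {v} → VertexOf x v → Star _◁[ x ]_ s v
    reach-vertex (_ , vw , wx) with ≺≺⇒alternating vw wx
    ... | inj₁ (a , va , a∈) = reach-input-target (feeds-wellFounded x a) a∈ va
    ... | inj₂ (a , va , ax) with source-unique (subst (_ ≺⁻_) (γ-unique ax gx) va)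
    ... | refl = ε

  twoCell-total : ∀ {x u v} → dim x ≡ 2 → VertexOf x u → VertexOf x v → u ≢ v →
                  u ◁[ x ]⁺ v ⊎ v ◁[ x ]⁺ u
  twoCell-total {x} d vu vv u≢v with γ-exists x (≡suc⇒1≤dim d)
  ... | g , gx with δ-nonempty g (≡suc⇒1≤dim (≺-dim-pred (inj₂ gx) d))
  ... | s , sg = Sum.map (λ p → ⋆⇒⁺ p u≢v) (λ p → ⋆⇒⁺ p (u≢v ∘ sym))
                   (⋆-comparable ◁[]-deterministic (reach-vertex vu) (reach-vertex vv))
    where open TwoCell d gx sg

  Spans : El → El → Set
  Spans b e = ∀ {u v} → u ≺⁻ e → v ≺⁺ e → u ◁[ b ]⁺ v

  twoCell-faces-spanned : ∀ {x e} → dim x ≡ 2 → e ≺ x → Spans x e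
  twoCell-faces-spanned d (inj₁ e∈) ue ve = [ _ , e∈ , ue , ve ]
  twoCell-faces-spanned d (inj₂ ex) ue ve =
    ⋆⇒⁺ (TwoCell.reach-vertex d ex ue (_ , inj₂ ve , inj₂ ex))
        (λ u≡v → not-both ue (subst (_≺⁺ _) (sym u≡v) ve))

  -- Base k x b : b = γᵏ(x) and dim b = 2.
  data Base : ℕ → El → El → Set where
    here : ∀ {x} → dim x ≡ 2 → Base zero x x
    step : ∀ {k x g b} → g ≺⁺ x → Base k g b → Base (suc k) x b

  base-dim : ∀ {k x b} → Base k x b → dim x ≡ 2 + k
  base-dim (here d) = d
  base-dim (step gx bs) = trans (≺-dim (inj₂ gx)) (cong suc (base-dim bs))

  base-dim₂ : ∀ {k x b} → Base k x b → dim b ≡ 2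
  base-dim₂ (here d) = d
  base-dim₂ (step _ bs) = base-dim₂ bs

  base-exists : ∀ k {x} → dim x ≡ 2 + k → ∃ (Base k x)
  base-exists zero d = _ , here d
  base-exists (suc k) d with γ-exists _ (≡suc⇒1≤dim d)
  ... | g , gx = Product.map₂ (step gx) (base-exists k (≺-dim-pred (inj₂ gx) d))

  base-input-below-input : ∀ {k y b e} → Base k y b → e ≺⁻ b → ∃ λ z → z ≺⁻ y × e ≤P z
  base-input-below-input (here _) e∈ = _ , e∈ , ε
  base-input-below-input (step gy bs) e∈ with base-input-below-input bs e∈
  ... | _ , z′g , ez′ with δγ⇒δδ z′g gy
  ... | z , z′z , zy = z , zy , ez′ ◅◅ (inj₁ z′z ◅ ε)

  SpansBelow : El → El → Set
  SpansBelow b y = ∀ {e} → e ≤P y → dim e ≡ 1 → Spans b e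

  spansBelow-≤P : ∀ {b y z} → SpansBelow b y → z ≤P y → SpansBelow b z
  spansBelow-≤P S zy ez = S (ez ◅◅ zy)

  spansBelow-faces : ∀ {b y} → 2 ≤ dim y → (∀ {z} → z ≺ y → SpansBelow b z) → SpansBelow b y
  spansBelow-faces 2≤dim S ey de with unsnoc⋆ ey
  ... | inj₁ refl = ⊥-elim (1+n≰n (subst (2 ≤_) de 2≤dim))
  ... | inj₂ (_ , ez , zy) = S zy ez de

  spansBelow-twoCell : ∀ {x} → dim x ≡ 2 → SpansBelow x x
  spansBelow-twoCell d ex de = twoCell-faces-spanned d (≤P-codim1 ex (trans d (cong suc (sym de))))

  ◁[]⁺-rebase : ∀ {b b′ u v} → (∀ {e} → e ≺⁻ b′ → Spans b e) → u ◁[ b′ ]⁺ v → u ◁[ b ]⁺ v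
  ◁[]⁺-rebase S = concatMap⁺ λ (_ , e∈ , ue , ve) → S e∈ ue ve

  spansBelow-from-inputs : ∀ {k b b′ y} → Base k y b′ → SpansBelow b′ y →
                           (∀ {z} → z ≺⁻ y → SpansBelow b z) → SpansBelow b y
  spansBelow-from-inputs bs′ S′ S ey de ue ve = ◁[]⁺-rebase input-spanned (S′ ey de ue ve)
    where
    input-spanned : ∀ {e} → e ≺⁻ _ → Spans _ e
    input-spanned e∈ with base-input-below-input bs′ e∈
    ... | _ , zy , ez = S zy ez (≺-dim-pred (inj₁ e∈) (base-dim₂ bs′))

  spansBelow-base : ∀ {k x b} → Base k x b → SpansBelow b x
  spansBelow-base (here d) = spansBelow-twoCell d
  spansBelow-base {suc k} {x} {b} xbs@(step {g = g} gx bs) = spansBelow-faces 2≤dim face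
    where
    2≤dim : 2 ≤ dim x
    2≤dim = subst (2 ≤_) (sym (base-dim xbs)) (m≤m+n 2 _)

    spans-g : SpansBelow b g
    spans-g = spansBelow-base bs

    spans-input : ∀ {y} → Acc (Feeds x) y → y ≺⁻ x → SpansBelow b y
    spans-input {y} (acc rec) yx =
      spansBelow-from-inputs ybs (spansBelow-base ybs) spans-inputs
      where
      ybs : Base k y _
      ybs = proj₂ (base-exists k (≺-dim-pred (inj₁ yx) (base-dim xbs)))
      -- By oriented thinness, an input of y is an output of an input of x feeding y, or an input of γ x.
      spans-inputs : ∀ {z} → z ≺⁻ y → SpansBelow b z
      spans-inputs zy with ≺≺⇒alternating (inj₁ zy) (inj₁ yx)
      ... | inj₁ (_ , zy′ , y′x) =
        spansBelow-≤P (spans-input (rec (y′x , yx , _ , zy′ , zy)) y′x) (inj₂ zy′ ◅ ε)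
      ... | inj₂ (_ , zy′ , y′x) with γ-unique y′x gx
      ... | refl = spansBelow-≤P spans-g (inj₁ zy′ ◅ ε)

    face : ∀ {z} → z ≺ x → SpansBelow b z
    face (inj₁ zx) = spans-input (feeds-wellFounded x _) zx
    face (inj₂ zx) with γ-unique zx gx
    ... | refl = spans-g

  VerticesLinearlyOrdered : Set
  VerticesLinearlyOrdered =
    (∀ a → dim a ≡ 0 → ¬ (a <⁺ a))
      × (∀ a b → dim a ≡ 0 → dim b ≡ 0 → a ≢ b → (a <⁺ b) ⊎ (b <⁺ a))

  module _ {t} (below-t : ∀ x → x ≤P t) where

    same-dim-as-t : ∀ {a} → dim a ≡ dim t → a ≡ t
    same-dim-as-t = ≤P-dim-≡ (below-t _)

    vertex-has-coface : ∀ {a} → dim a ≡ 0 → 1 ≤ dim t → ∃ λ c → a ≺ c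
    vertex-has-coface {a} da 1≤dim with below-t a
    ... | ε = ⊥-elim (1+n≰n (subst (1 ≤_) da 1≤dim))
    ... | r ◅ _ = _ , r

    linear-if-dim0 : dim t ≡ 0 → VerticesLinearlyOrdered
    linear-if-dim0 dt = irreflexive , total
      where
      irreflexive : ∀ a → dim a ≡ 0 → ¬ (a <⁺ a)
      irreflexive a _ p with uncons⁺ p
      ... | _ , (c , ac , _) , _ = n≮0 (subst₂ _≤_ (≺-dim (inj₁ ac)) dt (≤P-dim (below-t c)))
      total : ∀ a b → dim a ≡ 0 → dim b ≡ 0 → a ≢ b → (a <⁺ b) ⊎ (b <⁺ a)
      total a b da db a≢b = ⊥-elim (a≢b (trans (same-dim-as-t (trans da (sym dt)))
                                               (sym (same-dim-as-t (trans db (sym dt))))))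

    linear-if-dim1 : dim t ≡ 1 → VerticesLinearlyOrdered
    linear-if-dim1 dt = irreflexive , total
      where
      coface-is-t : ∀ {u c} → u ≺ c → c ≡ t
      coface-is-t {c = c} uc =
        same-dim-as-t (≤-antisym (≤P-dim (below-t c)) (subst (_≤ dim c) (sym dt) (≺⇒1≤dim uc)))
      vertex-face : ∀ {a} → dim a ≡ 0 → a ≺ t
      vertex-face da with vertex-has-coface da (≡suc⇒1≤dim dt)
      ... | _ , ac with coface-is-t ac
      ... | refl = ac
      ◁-via-t : ∀ {u v} → u ◁⁺ v → u ≺⁻ t × v ≺⁺ t
      ◁-via-t (_ , uc , vc) with coface-is-t (inj₁ uc)
      ... | refl = uc , vc
      irreflexive : ∀ a → dim a ≡ 0 → ¬ (a <⁺ a)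
      irreflexive a _ p =
        not-both (proj₁ (◁-via-t (proj₁ (proj₂ (uncons⁺ p))))) (proj₂ (◁-via-t (proj₂ (last⁺ p))))
      total : ∀ a b → dim a ≡ 0 → dim b ≡ 0 → a ≢ b → (a <⁺ b) ⊎ (b <⁺ a)
      total a b da db a≢b with vertex-face da | vertex-face db
      ... | inj₁ at | inj₁ bt = ⊥-elim (a≢b (δ-singleton t dt at bt))
      ... | inj₂ at | inj₂ bt = ⊥-elim (a≢b (γ-unique at bt))
      ... | inj₁ at | inj₂ bt = inj₁ [ t , at , bt ]
      ... | inj₂ at | inj₁ bt = inj₂ [ t , bt , at ]

    linear-if-base : ∀ {k b} → Base k t b → VerticesLinearlyOrdered
    linear-if-base {b = b} bs = irreflexive , total
      where
      spans : SpansBelow b t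
      spans = spansBelow-base bs
      spans-coface : ∀ {a c} → dim a ≡ 0 → a ≺ c → Spans b c
      spans-coface da ac = spans (below-t _) (edge-dim da ac)
      <⁺⇒◁[]⁺ : ∀ {u v} → dim u ≡ 0 → u <⁺ v → u ◁[ b ]⁺ v
      <⁺⇒◁[]⁺ du [ _ , uc , vc ] = spans-coface du (inj₁ uc) uc vc
      <⁺⇒◁[]⁺ du (s@(_ , uc , vc) ∷ p) =
        spans-coface du (inj₁ uc) uc vc ++ <⁺⇒◁[]⁺ (◁⁺-vertex du s) p
      vertex-of-base : ∀ {a} → dim a ≡ 0 → VertexOf b a
      vertex-of-base da with vertex-has-coface da (≡suc⇒1≤dim (base-dim bs))
      ... | _ , inj₁ ac =
        ◁[]⁺-source (spans-coface da (inj₁ ac) ac (proj₂ (γ-exists _ (≺⇒1≤dim (inj₁ ac)))))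
      ... | _ , inj₂ ac =
        ◁[]⁺-target (spans-coface da (inj₂ ac) (proj₂ (δ-nonempty _ (≺⇒1≤dim (inj₂ ac)))) ac)
      irreflexive : ∀ a → dim a ≡ 0 → ¬ (a <⁺ a)
      irreflexive a da = ◁[]⁺-irreflexive ∘ <⁺⇒◁[]⁺ da
      total : ∀ a b → dim a ≡ 0 → dim b ≡ 0 → a ≢ b → (a <⁺ b) ⊎ (b <⁺ a)
      total a b da db a≢b = Sum.map ◁[]⁺⇒<⁺ ◁[]⁺⇒<⁺
        (twoCell-total (base-dim₂ bs) (vertex-of-base da) (vertex-of-base db) a≢b)

  verticesLinearlyOrdered : VerticesLinearlyOrdered
  verticesLinearlyOrdered with greatest
  ... | t , below-t with dim t in dt
  ... | zero = linear-if-dim0 below-t dt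
  ... | suc zero = linear-if-dim1 below-t dt
  ... | suc (suc k) = linear-if-base below-t (proj₂ (base-exists k dt))

mainTheorem8 : (C : DendriticFaceComplex) →
    let open DendriticFaceComplex C in
    (∀ a → dim a ≡ 0 → ¬ (a <⁺ a))
      × (∀ a b → dim a ≡ 0 → dim b ≡ 0 → a ≢ b → (a <⁺ b) ⊎ (b <⁺ a))
mainTheorem8 = verticesLinearlyOrdered
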